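{- Let $X \in \{\mathrm{ID}, \mathrm{ITD}\}$, let $G$ be an X-admissible graph of order $n$, and let $k = \lceil \log_2 (n+1) \rceil \ge 3$. Then $\gamma^{X}(G) = k$ if and only if $G$ can be obtained (up to isomorphism) from some graph $G^I(k) = (C \cup (V\setminus C), E)$ for which $G^I(k)[C]$ is X-admissible, by removing at most $2^{k-1}-1$ vertices of $V \setminus C$.
   Context: Graphs are finite, simple and undirected. For a graph $G=(V,E)$ and $v\in V$, $N(v)$ is the open neighborhood and $N[v]=N(v)\cup\{v\}$ the closed neighborhood; $G[C]$ is the subgraph induced by $C$. Closed twins are distinct adjacent vertices $u,v$ with $N[u]=N[v]$. A set $C\subseteq V$ is dominating (resp. total-dominating) if $N[v]\cap C\neq\emptyset$ (resp. $N(v)\cap C\ne\emptyset$) for all $v\in V$. A set $C$ is closed-separating if $N[u]\cap C\neq N[v]\cap C$ for all distinct $u,v\in V$. An ID-code (resp. ITD-code) is a set that is closed-separating and dominating (resp. total-dominating). A graph is X-admissible if it has an X-code; $\gamma^{X}(G)$ is the minimum cardinality of an X-code of $G$. For $k\ge 2$, $G^I(k)$ denotes any graph with vertex set $V$ and a subset $C\subseteq V$ such that $|C|=k$, the induced subgraph $G^I(k)[C]$ has no closed twins, and $V\setminus C$ consists of exactly one vertex $v_{C'}$ with $N(v_{C'})\cap C=C'$ for each non-empty subset $C'\subseteq C$ such that there is no vertex $u\in C$ with $N[u]\cap C=C'$; there is no condition on the edges inside $V\setminus C$. -}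

module Defs where

open import Data.Fin using (Fin; zero; suc)
open import Data.Fin.Subset
  using (Subset; inside; outside; _∈_; _∉_; _⊆_; _∩_; _∪_; ∁; ⁅_⁆; ∣_∣; Nonempty)
open import Data.Nat using (ℕ; _≤_)
open import Data.Product using (∃; ∃!; _×_)
open import Data.Vec using ([]; _∷_; tabulate)
open import Function.Bundles using (_⇔_; _↔_; Inverse)
open import Level using (0ℓ)
open import Relation.Binary.Core using (Rel)
open import Relation.Binary.Definitions using (Decidable; Symmetric)
open import Relation.Binary.PropositionalEquality using (_≡_; _≢_)
open import Relation.Nullary using (¬_; does)

record Graph (n : ℕ) : Set₁ where
  field
    Adj        : Rel (Fin n) 0ℓ
    Adj?       : Decidable Adj
    Adj-sym    : Symmetric Adj
    Adj-irrefl : ∀ {v} → ¬ Adj v v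

  N⟨_⟩ : Fin n → Subset n
  N⟨ v ⟩ = tabulate λ u → does (Adj? v u)

  N[_] : Fin n → Subset n
  N[ v ] = N⟨ v ⟩ ∪ ⁅ v ⁆

  ClosedTwins : Fin n → Fin n → Set
  ClosedTwins u v = u ≢ v × Adj u v × N[ u ] ≡ N[ v ]

  HasNoClosedTwins : Set
  HasNoClosedTwins = ∀ {u v} → ¬ ClosedTwins u v

  Dominating : Subset n → Set
  Dominating C = ∀ v → Nonempty (N[ v ] ∩ C)

  TotalDominating : Subset n → Set
  TotalDominating C = ∀ v → Nonempty (N⟨ v ⟩ ∩ C)

  ClosedSeparating : Subset n → Set
  ClosedSeparating C = ∀ {u v} → u ≢ v → N[ u ] ∩ C ≢ N[ v ] ∩ C

-- The i-th smallest element of p.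
element : ∀ {n} (p : Subset n) → Fin ∣ p ∣ → Fin n
element (inside  ∷ p) zero    = zero
element (inside  ∷ p) (suc i) = suc (element p i)
element (outside ∷ p) i       = suc (element p i)

-- The induced subgraph; its vertices are the elements of p, renumbered in
-- increasing order.
_[_] : ∀ {n} → Graph n → (p : Subset n) → Graph ∣ p ∣
G [ p ] = record
  { Adj        = λ i j → Adj (element p i) (element p j)
  ; Adj?       = λ i j → Adj? (element p i) (element p j)
  ; Adj-sym    = Adj-sym
  ; Adj-irrefl = Adj-irrefl
  }
  where open Graph G

infix 4 _≅_
record _≅_ {m n} (G : Graph m) (H : Graph n) : Set where
  field
    bijection : Fin m ↔ Fin n
  open Inverse bijection using (to)
  field
    Adj-⇔ : ∀ u v → Graph.Adj G u v ⇔ Graph.Adj H (to u) (to v)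

data CodeType : Set where
  ID ITD : CodeType

IsCode : ∀ {n} → CodeType → Graph n → Subset n → Set
IsCode ID  G C = Graph.ClosedSeparating G C × Graph.Dominating G C
IsCode ITD G C = Graph.ClosedSeparating G C × Graph.TotalDominating G C

Admissible : ∀ {n} → CodeType → Graph n → Set
Admissible X G = ∃ λ C → IsCode X G C

-- γ X ⟨ G ⟩≐ k states that k is the minimum cardinality of an X-code of G.
-- It is a relation because G need not have any X-code.
infix 4 γ_⟨_⟩≐_
γ_⟨_⟩≐_ : ∀ {n} → CodeType → Graph n → ℕ → Set
γ X ⟨ G ⟩≐ k =
  (∃ λ C → IsCode X G C × ∣ C ∣ ≡ k) ×
  (∀ C → IsCode X G C → k ≤ ∣ C ∣)

module _ {n : ℕ} (G : Graph n) (C : Subset n) where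
  open Graph G

  -- The subsets C′ for which G^I(k) has a vertex v_C′ outside C.
  Unrealized : Subset n → Set
  Unrealized C′ =
    C′ ⊆ C × Nonempty C′ × ¬ (∃ λ u → u ∈ C × N[ u ] ∩ C ≡ C′)

  -- G, with the distinguished set C, is a graph G^I(k).
  record IsGᴵ (k : ℕ) : Set where
    field
      2≤k      : 2 ≤ k
      ∣C∣≡k    : ∣ C ∣ ≡ k
      no-twins : Graph.HasNoClosedTwins (G [ C ])
      exactly-one : ∀ {C′} → Unrealized C′ →
                    ∃! _≡_ λ v → v ∉ C × N⟨ v ⟩ ∩ C ≡ C′
      no-others   : ∀ {v} → v ∉ C →
                    ∃ λ C′ → Unrealized C′ × N⟨ v ⟩ ∩ C ≡ C′

-- An X-code C of G makes v ↦ N[v] ∩ C an injection into the non-empty subsets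
-- of C, so n + 1 ≤ 2 ^ ∣ C ∣ and no X-code is smaller than ⌈log₂ (n + 1)⌉. The
-- set C of a graph G^I(k) is an X-code meeting every closed neighbourhood in a
-- different non-empty subset, and remains one when vertices outside C are
-- removed. Conversely, adding to G one vertex for each non-empty subset of a
-- minimum X-code that is not yet of the form N[v] ∩ C yields a graph G^I(k); it
-- has fewer than 2 ^ k vertices, at least 2 ^ (k ∸ 1) of which belong to G.
module Submission where

open import Defs
import Data.Bool.Properties as Bool
import Data.Empty as Empty
open import Data.Fin using (Fin; zero; suc; _↑ˡ_; _↑ʳ_; _≟_; splitAt)
open import Data.Fin.Properties
  using (2↔Bool; *↔×; any?; injective⇒≤; suc-injective; ↑ˡ-injective;
         splitAt-↑ˡ; splitAt-↑ʳ; splitAt⁻¹-↑ˡ; splitAt⁻¹-↑ʳ)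
open import Data.Fin.Subset
  using (Subset; inside; outside; _∈_; _∉_; _⊆_; _∩_; ∁; ∣_∣; Nonempty; ⊥; ⊤)
open import Data.Fin.Subset.Properties
open import Data.Nat using (ℕ; zero; suc; _+_; _∸_; _^_; _≤_; _<_)
open import Data.Nat.Logarithm using (⌈log₂_⌉; ⌈log₂⌉-mono-≤; ⌈log₂2^n⌉≡n)
open import Data.Nat.Properties
  using (≤-trans; ≤-reflexive; ≤-antisym; +-comm; +-identityʳ; +-suc; +-monoˡ-≤;
         +-cancelˡ-≤; ∸-monoˡ-≤; ≮⇒≥; 1+n≰n; n≤1+n)
open import Data.Product
  using (Σ-syntax; ∃; ∃!; _×_; _,_; proj₁; proj₂; uncurry)
open import Data.Product.Function.NonDependent.Propositional using (_×-↔_)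
open import Data.Sum using (_⊎_; inj₁; inj₂)
import Data.Sum as Sum
open import Data.Vec using ([]; _∷_; _++_; here; there; lookup; tabulate; uncons)
open import Data.Vec.Properties
  using (lookup∘tabulate; tabulate∘lookup; tabulate-cong; lookup⇒[]=; []=⇒lookup;
         lookup-++ˡ; lookup-++ʳ; ≡-dec)
open import Function using (_∘_)
open import Function.Bundles using (_⇔_; mk⇔; _↔_; mk↔ₛ′; Inverse; Equivalence)
open import Function.Definitions using (Injective)
open import Function.Properties.Inverse using (↔-sym; ↔-trans)
open import Level using (0ℓ)
open import Relation.Binary.PropositionalEquality
  using (_≡_; _≢_; refl; sym; trans; cong; cong₂; subst; subst₂)
open import Relation.Nullary using (¬_; Dec; yes; no; does; contradiction; ¬?; _×-dec_)
open import Relation.Nullary.Decidable using (dec-true; decidable-stable)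
open import Relation.Unary using (Pred; Decidable)

private
  variable
    m n : ℕ

-- Subsets of Fin n

∈-tabulate⁺ : {P : Pred (Fin n) 0ℓ} (P? : Decidable P) →
              ∀ {x} → P x → x ∈ tabulate (does ∘ P?)
∈-tabulate⁺ P? {x} px =
  lookup⇒[]= x _ (trans (lookup∘tabulate (does ∘ P?) x) (dec-true (P? x) px))

∈-tabulate⁻ : {P : Pred (Fin n) 0ℓ} (P? : Decidable P) →
              ∀ {x} → x ∈ tabulate (does ∘ P?) → P x
∈-tabulate⁻ P? {x} x∈
  with P? x | trans (sym (lookup∘tabulate (does ∘ P?) x)) ([]=⇒lookup x∈)
... | yes px | _ = px

preimage : (Fin n → Fin m) → Subset m → Subset n
preimage f p = tabulate (lookup p ∘ f)

module _ {f : Fin n → Fin m} {p : Subset m} where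

  ∈-preimage⁺ : ∀ {x} → f x ∈ p → x ∈ preimage f p
  ∈-preimage⁺ {x} fx∈p =
    lookup⇒[]= x _ (trans (lookup∘tabulate (lookup p ∘ f) x) ([]=⇒lookup fx∈p))

  ∈-preimage⁻ : ∀ {x} → x ∈ preimage f p → f x ∈ p
  ∈-preimage⁻ {x} x∈ =
    lookup⇒[]= (f x) p (trans (sym (lookup∘tabulate (lookup p ∘ f) x)) ([]=⇒lookup x∈))

-- Surjectivity is asked only over `p`: the embeddings below may miss vertices of the larger graph,
-- but none of its code.
Covers : (Fin n → Fin m) → Subset m → Set
Covers f p = ∀ {y} → y ∈ p → ∃ λ x → f x ≡ y

module _ {f : Fin n → Fin m} {C : Subset m} (covers : Covers f C) where

  preimage-reflects-⊆ : ∀ {p q} → p ⊆ C → preimage f p ⊆ preimage f q → p ⊆ q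
  preimage-reflects-⊆ p⊆C p⊆q y∈p with covers (p⊆C y∈p)
  ... | _ , refl = ∈-preimage⁻ (p⊆q (∈-preimage⁺ y∈p))

  -- Each element of `C` is hit by `f`, so pulling back forgets nothing inside `C`. Traces
  -- `N[ v ] ∩ C` can therefore be compared after transport along `f`.
  preimage-injective : ∀ {p q} → p ⊆ C → q ⊆ C → preimage f p ≡ preimage f q → p ≡ q
  preimage-injective {p} {q} p⊆C q⊆C eq = ⊆-antisym
    (preimage-reflects-⊆ {q = q} p⊆C λ x∈ → subst (_ ∈_) eq x∈)
    (preimage-reflects-⊆ {q = p} q⊆C λ x∈ → subst (_ ∈_) (sym eq) x∈)

  preimage-nonempty : ∀ {p} → p ⊆ C → Nonempty p → Nonempty (preimage f p)
  preimage-nonempty p⊆C (y , y∈p) with covers (p⊆C y∈p)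
  ... | x , refl = x , ∈-preimage⁺ y∈p

element-∈ : (p : Subset n) (i : Fin ∣ p ∣) → element p i ∈ p
element-∈ (inside  ∷ p) zero    = here
element-∈ (inside  ∷ p) (suc i) = there (element-∈ p i)
element-∈ (outside ∷ p) i       = there (element-∈ p i)

element-injective : (p : Subset n) → Injective _≡_ _≡_ (element p)
element-injective (inside  ∷ p) {zero}  {zero}  eq = refl
element-injective (inside  ∷ p) {suc i} {suc j} eq =
  cong suc (element-injective p (suc-injective eq))
element-injective (outside ∷ p) eq = element-injective p (suc-injective eq)

element-covers : (p : Subset n) → Covers (element p) p
element-covers (inside  ∷ p) here = zero , refl
element-covers (inside  ∷ p) (there x∈p) with element-covers p x∈p
... | i , refl = suc i , refl
element-covers (outside ∷ p) (there x∈p) with element-covers p x∈p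
... | i , refl = i , refl

-- Sending an element of the preimage to the position of its image in `p` is injective because `f`
-- is.
∣preimage∣≤ : {f : Fin n → Fin m} → Injective _≡_ _≡_ f →
              ∀ p → ∣ preimage f p ∣ ≤ ∣ p ∣
∣preimage∣≤ {f = f} f-injective p = injective⇒≤ {f = proj₁ ∘ index} index-injective
  where
  q = preimage f p

  index : ∀ i → ∃ λ j → element p j ≡ f (element q i)
  index i = element-covers p (∈-preimage⁻ (element-∈ q i))

  index-injective : Injective _≡_ _≡_ (proj₁ ∘ index)
  index-injective {i} {j} eq = element-injective q (f-injective
    (trans (sym (proj₂ (index i))) (trans (cong (element p) eq) (proj₂ (index j)))))

∣p++q∣≡∣p∣+∣q∣ : (p : Subset m) (q : Subset n) → ∣ p ++ q ∣ ≡ ∣ p ∣ + ∣ q ∣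
∣p++q∣≡∣p∣+∣q∣ []            q = refl
∣p++q∣≡∣p∣+∣q∣ (inside  ∷ p) q = cong suc (∣p++q∣≡∣p∣+∣q∣ p q)
∣p++q∣≡∣p∣+∣q∣ (outside ∷ p) q = ∣p++q∣≡∣p∣+∣q∣ p q

-- Counting and enumerating subsets

Subset↔Fin : ∀ n → Subset n ↔ Fin (2 ^ n)
Subset↔Fin zero    = mk↔ₛ′ (λ _ → zero) (λ _ → []) (λ { zero → refl }) (λ { [] → refl })
Subset↔Fin (suc n) =
  ↔-trans (mk↔ₛ′ uncons (uncurry _∷_) (λ _ → refl) (λ { (_ ∷ _) → refl }))
  (↔-trans (↔-sym 2↔Bool ×-↔ Subset↔Fin n) (↔-sym *↔×))

Subset-to-injective : Injective _≡_ _≡_ (Inverse.to (Subset↔Fin n))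
Subset-to-injective {n} {p} {q} eq =
  trans (sym (strictlyInverseʳ p)) (trans (cong from eq) (strictlyInverseʳ q))
  where open Inverse (Subset↔Fin n)

Subset-from-injective : Injective _≡_ _≡_ (Inverse.from (Subset↔Fin n))
Subset-from-injective {n} {i} {j} eq =
  trans (sym (strictlyInverseˡ i)) (trans (cong to eq) (strictlyInverseˡ j))
  where open Inverse (Subset↔Fin n)

-- Pulled back along `element C`, the sets `p i` become distinct subsets of `Fin ∣ C ∣`, of which
-- there are `2 ^ ∣ C ∣`.
injectiveFamily⇒≤2^ : (C : Subset n) {p : Fin m → Subset n} → Injective _≡_ _≡_ p →
                      (∀ i → p i ⊆ C) → m ≤ 2 ^ ∣ C ∣
injectiveFamily⇒≤2^ C {p} p-injective p⊆C =
  injective⇒≤ {f = λ i → Inverse.to (Subset↔Fin ∣ C ∣) (preimage (element C) (p i))}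
    λ {i} {j} eq → p-injective
      (preimage-injective (element-covers C) (p⊆C i) (p⊆C j) (Subset-to-injective eq))

-- A listing without repetition. Its indices will serve as the added vertices: `injective` keeps
-- them separated, and `complete` leaves no subset without a vertex.
record Enumeration (P : Pred (Subset n) 0ℓ) : Set where
  field
    size      : ℕ
    at        : Fin size → Subset n
    injective : Injective _≡_ _≡_ at
    sound     : ∀ i → P (at i)
    complete  : ∀ {p} → P p → ∃ λ i → at i ≡ p

enumerate : {P : Pred (Subset n) 0ℓ} → Decidable P → Enumeration P
enumerate {n} {P} P? = record
  { size      = ∣ M ∣
  ; at        = from ∘ element M
  ; injective = λ eq → element-injective M (Subset-from-injective eq)
  ; sound     = λ i → ∈-tabulate⁻ (P? ∘ from) (element-∈ M i)
  ; complete  = complete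
  }
  where
  open Inverse (Subset↔Fin n)

  M : Subset (2 ^ n)
  M = tabulate (does ∘ P? ∘ from)

  complete : ∀ {p} → P p → ∃ λ i → from (element M i) ≡ p
  complete {p} Pp
    with element-covers M
           (∈-tabulate⁺ (P? ∘ from) (subst P (sym (strictlyInverseʳ p)) Pp))
  ... | i , eq = i , trans (cong from eq) (strictlyInverseʳ p)

-- Neighbourhoods and codes

module _ (G : Graph n) where
  open Graph G

  ∈-N⟨⟩⁺ : ∀ {v x} → Adj v x → x ∈ N⟨ v ⟩
  ∈-N⟨⟩⁺ {v} = ∈-tabulate⁺ (Adj? v)

  ∈-N⟨⟩⁻ : ∀ {v x} → x ∈ N⟨ v ⟩ → Adj v x
  ∈-N⟨⟩⁻ {v} = ∈-tabulate⁻ (Adj? v)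

  ∈-N[]⁺ : ∀ {v x} → Adj v x ⊎ x ≡ v → x ∈ N[ v ]
  ∈-N[]⁺ (inj₁ vx)   = x∈p∪q⁺ (inj₁ (∈-N⟨⟩⁺ vx))
  ∈-N[]⁺ (inj₂ refl) = x∈p∪q⁺ (inj₂ (x∈⁅x⁆ _))

  ∈-N[]⁻ : ∀ {v x} → x ∈ N[ v ] → Adj v x ⊎ x ≡ v
  ∈-N[]⁻ {v} x∈ = Sum.map ∈-N⟨⟩⁻ (x∈⁅y⁆⇒x≡y v) (x∈p∪q⁻ N⟨ v ⟩ _ x∈)

  -- Bridges the open neighbourhoods in the definition of `IsGᴵ` and the closed ones in that of
  -- separation; they differ only in `v`, which is outside `C`.
  N⟨⟩∩≡N[]∩ : ∀ C {v} → v ∉ C → N⟨ v ⟩ ∩ C ≡ N[ v ] ∩ C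
  N⟨⟩∩≡N[]∩ C {v} v∉C = ⊆-antisym ⊆₁ ⊆₂
    where
    ⊆₁ : N⟨ v ⟩ ∩ C ⊆ N[ v ] ∩ C
    ⊆₁ x∈ with x∈p∩q⁻ N⟨ v ⟩ C x∈
    ... | x∈N , x∈C = x∈p∩q⁺ (x∈p∪q⁺ (inj₁ x∈N) , x∈C)

    ⊆₂ : N[ v ] ∩ C ⊆ N⟨ v ⟩ ∩ C
    ⊆₂ x∈ with x∈p∩q⁻ N[ v ] C x∈
    ... | x∈N , x∈C with ∈-N[]⁻ x∈N
    ...   | inj₁ vx   = x∈p∩q⁺ (∈-N⟨⟩⁺ vx , x∈C)
    ...   | inj₂ refl = contradiction x∈C v∉C

  totalDominating⇒dominating : ∀ {C} → TotalDominating C → Dominating C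
  totalDominating⇒dominating {C} total v with total v
  ... | x , x∈ with x∈p∩q⁻ N⟨ v ⟩ C x∈
  ...   | x∈N , x∈C = x , x∈p∩q⁺ (x∈p∪q⁺ (inj₁ x∈N) , x∈C)

  isCode⇒ID : ∀ X {C} → IsCode X G C → IsCode ID G C
  isCode⇒ID ID  code          = code
  isCode⇒ID ITD (sep , total) = sep , totalDominating⇒dominating total

  order<2^∣code∣ : ∀ {C} → IsCode ID G C → n < 2 ^ ∣ C ∣
  order<2^∣code∣ {C} (separating , dominating) =
    injectiveFamily⇒≤2^ C {trace} trace-injective trace⊆C
    where
    trace : Fin (suc n) → Subset n
    -- The empty set is added as one more trace. Domination keeps it apart from the others, and it
    -- makes the inequality strict.
    trace zero    = ⊥
    trace (suc v) = N[ v ] ∩ C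

    trace⊆C : ∀ i → trace i ⊆ C
    trace⊆C zero    x∈⊥ = contradiction x∈⊥ ∉⊥
    trace⊆C (suc v)     = p∩q⊆q N[ v ] C

    ⊥≢trace : ∀ v → ⊥ ≢ trace (suc v)
    ⊥≢trace v eq with dominating v
    ... | x , x∈ = ∉⊥ (subst (x ∈_) (sym eq) x∈)

    trace-injective : Injective _≡_ _≡_ trace
    trace-injective {zero}  {zero}  eq = refl
    trace-injective {zero}  {suc v} eq = contradiction eq (⊥≢trace v)
    trace-injective {suc u} {zero}  eq = contradiction (sym eq) (⊥≢trace u)
    trace-injective {suc u} {suc v} eq with u ≟ v
    ... | yes refl = refl
    ... | no u≢v   = contradiction eq (separating u≢v)

-- Embeddings as induced subgraphs, and codes pulled back along them

record Embedding (G : Graph n) (H : Graph m) : Set where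
  private
    module G = Graph G
    module H = Graph H
  field
    fun       : Fin n → Fin m
    injective : Injective _≡_ _≡_ fun
    preserves : ∀ {u v} → G.Adj u v → H.Adj (fun u) (fun v)
    reflects  : ∀ {u v} → H.Adj (fun u) (fun v) → G.Adj u v

module _ {G : Graph n} {H : Graph m} (ι : Embedding G H) where
  open Embedding ι
  private
    module G = Graph G
    module H = Graph H

  preimage-N⟨⟩∩ : ∀ C u → preimage fun (H.N⟨ fun u ⟩ ∩ C) ≡ G.N⟨ u ⟩ ∩ preimage fun C
  preimage-N⟨⟩∩ C u = ⊆-antisym ⊆₁ ⊆₂
    where
    ⊆₁ : preimage fun (H.N⟨ fun u ⟩ ∩ C) ⊆ G.N⟨ u ⟩ ∩ preimage fun C
    ⊆₁ x∈ with x∈p∩q⁻ _ C (∈-preimage⁻ x∈)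
    ... | x∈N , x∈C = x∈p∩q⁺ (∈-N⟨⟩⁺ G (reflects (∈-N⟨⟩⁻ H x∈N)) , ∈-preimage⁺ x∈C)

    ⊆₂ : G.N⟨ u ⟩ ∩ preimage fun C ⊆ preimage fun (H.N⟨ fun u ⟩ ∩ C)
    ⊆₂ x∈ with x∈p∩q⁻ G.N⟨ u ⟩ _ x∈
    ... | x∈N , x∈C = ∈-preimage⁺
      (x∈p∩q⁺ (∈-N⟨⟩⁺ H (preserves (∈-N⟨⟩⁻ G x∈N)) , ∈-preimage⁻ x∈C))

  preimage-N[]∩ : ∀ C u → preimage fun (H.N[ fun u ] ∩ C) ≡ G.N[ u ] ∩ preimage fun C
  preimage-N[]∩ C u = ⊆-antisym ⊆₁ ⊆₂
    where
    ⊆₁ : preimage fun (H.N[ fun u ] ∩ C) ⊆ G.N[ u ] ∩ preimage fun C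
    ⊆₁ x∈ with x∈p∩q⁻ _ C (∈-preimage⁻ x∈)
    ... | x∈N , x∈C =
      -- Injectivity deals with the centre of the closed neighbourhood, where `fun x ≡ fun u` has to
      -- give `x ≡ u`.
      x∈p∩q⁺ (∈-N[]⁺ G (Sum.map reflects injective (∈-N[]⁻ H x∈N)) , ∈-preimage⁺ x∈C)

    ⊆₂ : G.N[ u ] ∩ preimage fun C ⊆ preimage fun (H.N[ fun u ] ∩ C)
    ⊆₂ x∈ with x∈p∩q⁻ G.N[ u ] _ x∈
    ... | x∈N , x∈C = ∈-preimage⁺
      (x∈p∩q⁺ (∈-N[]⁺ H (Sum.map preserves (cong fun) (∈-N[]⁻ G x∈N)) , ∈-preimage⁻ x∈C))

  module _ {C : Subset m} (covers : Covers fun C) where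

    -- Traces in `G` are pull-backs of traces in `H`. The latter lie in the covered set `C`, so they
    -- stay distinct.
    preimage-separating : H.ClosedSeparating C → G.ClosedSeparating (preimage fun C)
    preimage-separating separating {u} {v} u≢v eq = separating (u≢v ∘ injective)
      (preimage-injective covers (p∩q⊆q _ C) (p∩q⊆q _ C)
        (trans (preimage-N[]∩ C u) (trans eq (sym (preimage-N[]∩ C v)))))

    preimage-dominating : H.Dominating C → G.Dominating (preimage fun C)
    preimage-dominating dominating u = subst Nonempty (preimage-N[]∩ C u)
      (preimage-nonempty covers (p∩q⊆q _ C) (dominating (fun u)))

    preimage-totalDominating : H.TotalDominating C → G.TotalDominating (preimage fun C)
    preimage-totalDominating total u = subst Nonempty (preimage-N⟨⟩∩ C u)
      (preimage-nonempty covers (p∩q⊆q _ C) (total (fun u)))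

    preimage-isCode : ∀ X → IsCode X H C → IsCode X G (preimage fun C)
    preimage-isCode ID  (sep , dom)   = preimage-separating sep , preimage-dominating dom
    preimage-isCode ITD (sep , total) =
      preimage-separating sep , preimage-totalDominating total

induced : (G : Graph n) (p : Subset n) → Embedding (G [ p ]) G
induced G p = record
  { fun       = element p
  ; injective = element-injective p
  ; preserves = λ uv → uv
  ; reflects  = λ uv → uv
  }

≅⇒embedding : {G : Graph n} {H : Graph m} (p : Subset m) → G ≅ H [ p ] →
              Σ[ ι ∈ Embedding G H ] Covers (Embedding.fun ι) p
≅⇒embedding p iso = record
  { fun       = element p ∘ to
  ; injective = λ {u} {v} eq → trans (sym (strictlyInverseʳ u))
      (trans (cong from (element-injective p eq)) (strictlyInverseʳ v))
  ; preserves = Equivalence.to (Adj-⇔ _ _)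
  ; reflects  = Equivalence.from (Adj-⇔ _ _)
  } , covers
  where
  open _≅_ iso
  open Inverse bijection

  covers : Covers (element p ∘ to) p
  covers x∈p with element-covers p x∈p
  ... | i , refl = from i , cong (element p) (strictlyInverseˡ i)

embedding⇒≅ : {G : Graph n} {H : Graph m} (ι : Embedding G H) (p : Subset m) →
              (∀ u → Embedding.fun ι u ∈ p) → Covers (Embedding.fun ι) p → G ≅ H [ p ]
embedding⇒≅ {G = G} {H} ι p fun∈p covers = record
  { bijection = mk↔ₛ′ (proj₁ ∘ index) (proj₁ ∘ vertex)
      (λ i → element-injective p (trans (proj₂ (index _)) (proj₂ (vertex i))))
      (λ u → injective (trans (proj₂ (vertex _)) (proj₂ (index u))))
  ; Adj-⇔ = λ u v → mk⇔
      (λ uv → subst₂ H.Adj (sym (proj₂ (index u))) (sym (proj₂ (index v))) (preserves uv))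
      (λ uv → reflects (subst₂ H.Adj (proj₂ (index u)) (proj₂ (index v)) uv))
  }
  where
  open Embedding ι
  module H = Graph H

  index : ∀ u → ∃ λ i → element p i ≡ fun u
  index u = element-covers p (fun∈p u)

  vertex : ∀ i → ∃ λ u → fun u ≡ element p i
  vertex i = covers (element-∈ p i)

-- The graphs G^I(k)

module _ (H : Graph m) (C : Subset m) where
  open Graph H

  -- Unlike in `Unrealized`, the vertex `v` may lie outside `C`.
  Realized : Subset m → Set
  Realized E = ∃ λ v → N[ v ] ∩ C ≡ E

  realized? : Decidable Realized
  realized? E = any? λ v → ≡-dec Bool._≟_ (N[ v ] ∩ C) E

  separating⇒noClosedTwins : ClosedSeparating C → Graph.HasNoClosedTwins (H [ C ])
  separating⇒noClosedTwins separating (u≢v , _ , eq) =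
    preimage-separating (induced H C) (element-covers C) separating u≢v
      (cong (_∩ preimage (element C) C) eq)

  -- Saturation gives every non-empty subset of `C` a vertex with that trace, and separation makes
  -- the vertex unique. So a subset not realized inside `C` belongs to exactly one vertex outside,
  -- and the trace of a vertex outside is never realized inside.
  isGᴵ : 2 ≤ ∣ C ∣ → IsCode ID H C →
         (∀ {E} → E ⊆ C → Nonempty E → Realized E) → IsGᴵ H C ∣ C ∣
  isGᴵ 2≤∣C∣ (separating , dominating) saturated = record
    { 2≤k         = 2≤∣C∣
    ; ∣C∣≡k       = refl
    ; no-twins    = separating⇒noClosedTwins separating
    ; exactly-one = exactly-one
    ; no-others   = λ {v} v∉C → N⟨ v ⟩ ∩ C , unrealized v∉C , refl
    }
    where
    trace-injective : ∀ {u v} → N[ u ] ∩ C ≡ N[ v ] ∩ C → u ≡ v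
    trace-injective {u} {v} eq =
      decidable-stable (u ≟ v) λ u≢v → separating u≢v eq

    unrealized : ∀ {v} → v ∉ C → Unrealized H C (N⟨ v ⟩ ∩ C)
    unrealized {v} v∉C =
      p∩q⊆q N⟨ v ⟩ C ,
      subst Nonempty (sym (N⟨⟩∩≡N[]∩ H C v∉C)) (dominating v) ,
      λ { (u , u∈C , eq) → v∉C
            (subst (_∈ C) (trace-injective (trans eq (N⟨⟩∩≡N[]∩ H C v∉C))) u∈C) }

    exactly-one : ∀ {E} → Unrealized H C E → ∃! _≡_ λ v → v ∉ C × N⟨ v ⟩ ∩ C ≡ E
    exactly-one (E⊆C , E≢∅ , ¬realized) with saturated E⊆C E≢∅
    ... | v , eq =
      v , (v∉C , trans (N⟨⟩∩≡N[]∩ H C v∉C) eq) ,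
      λ { (w∉C , eq′) → trace-injective
            (trans eq (trans (sym eq′) (N⟨⟩∩≡N[]∩ H C w∉C))) }
      where
      v∉C : v ∉ C
      v∉C v∈C = ¬realized (v , v∈C , eq)

  module _ {k : ℕ} (isGᴵ : IsGᴵ H C k) where
    open IsGᴵ isGᴵ

    trace-unrealized : ∀ {v} → v ∉ C → Unrealized H C (N[ v ] ∩ C)
    trace-unrealized v∉C with no-others v∉C
    ... | E , unrealized , eq =
      subst (Unrealized H C) (trans (sym eq) (N⟨⟩∩≡N[]∩ H C v∉C)) unrealized

    trace-∈ : ∀ {v} → v ∈ C → v ∈ N[ v ] ∩ C
    trace-∈ v∈C = x∈p∩q⁺ (∈-N[]⁺ H (inj₂ refl) , v∈C)

    isGᴵ⇒dominating : Dominating C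
    isGᴵ⇒dominating v with v ∈? C
    ... | yes v∈C = v , trace-∈ v∈C
    ... | no  v∉C = proj₁ (proj₂ (trace-unrealized v∉C))

    -- For two vertices outside `C`, `exactly-one` identifies them. If just one is outside, its
    -- trace is by definition not realized in `C`. Two vertices of `C` with equal traces would be
    -- closed twins in `H [ C ]`.
    isGᴵ⇒separating : ClosedSeparating C
    isGᴵ⇒separating {u} {v} u≢v eq with u ∈? C | v ∈? C
    ... | no u∉C  | no v∉C  with exactly-one (trace-unrealized v∉C)
    ...   | w , _ , unique = u≢v (trans
              (sym (unique (u∉C , trans (N⟨⟩∩≡N[]∩ H C u∉C) eq)))
              (unique (v∉C , N⟨⟩∩≡N[]∩ H C v∉C)))
    isGᴵ⇒separating {u} {v} u≢v eq
        | yes u∈C | no v∉C  = proj₂ (proj₂ (trace-unrealized v∉C)) (u , u∈C , eq)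
    isGᴵ⇒separating {u} {v} u≢v eq
        | no u∉C  | yes v∈C = proj₂ (proj₂ (trace-unrealized u∉C)) (v , v∈C , sym eq)
    isGᴵ⇒separating {u} {v} u≢v eq
        | yes u∈C | yes v∈C with element-covers C u∈C | element-covers C v∈C
    ...   | i , refl | j , refl = no-twins (i≢j , adjacent , twins)
      where
      i≢j : i ≢ j
      i≢j = u≢v ∘ cong (element C)

      adjacent : Adj (element C i) (element C j)
      -- A vertex of `C` lies in its own trace, hence `v` lies in that of `u`.
      adjacent with ∈-N[]⁻ H (p∩q⊆p _ C (subst (_ ∈_) (sym eq) (trace-∈ v∈C)))
      ... | inj₁ uv  = uv
      ... | inj₂ v≡u = contradiction (sym v≡u) u≢v

      -- Within `H [ C ]` the set `C` is the whole vertex set, so traces there are full closed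
      -- neighbourhoods.
      absorb : ∀ p → p ∩ preimage (element C) C ≡ p
      absorb p = ⊆-antisym (p∩q⊆p p _) λ x∈p → x∈p∩q⁺ (x∈p , ∈-preimage⁺ (element-∈ C _))

      twins : Graph.N[_] (H [ C ]) i ≡ Graph.N[_] (H [ C ]) j
      twins = trans (sym (absorb _))
        (trans (sym (preimage-N[]∩ (induced H C) C i))
        (trans (cong (preimage (element C)) eq)
        (trans (preimage-N[]∩ (induced H C) C j) (absorb _))))

    -- Outside `C`, open and closed traces agree and domination suffices. A vertex of `C` has a
    -- neighbour in `C` because some ITD-code of `H [ C ]` totally dominates it.
    isGᴵ⇒totalDominating : Admissible ITD (H [ C ]) → TotalDominating C
    isGᴵ⇒totalDominating (D , _ , total) v with v ∈? C
    ... | no v∉C = subst Nonempty (sym (N⟨⟩∩≡N[]∩ H C v∉C)) (isGᴵ⇒dominating v)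
    ... | yes v∈C with element-covers C v∈C
    ...   | i , refl with total i
    ...     | j , j∈ = element C j , x∈p∩q⁺
                (∈-N⟨⟩⁺ H (∈-N⟨⟩⁻ (H [ C ]) (p∩q⊆p _ D j∈)) , element-∈ C j)

    isGᴵ⇒isCode : ∀ X → Admissible X (H [ C ]) → IsCode X H C
    isGᴵ⇒isCode ID  _          = isGᴵ⇒separating , isGᴵ⇒dominating
    isGᴵ⇒isCode ITD admissible = isGᴵ⇒separating , isGᴵ⇒totalDominating admissible

-- Saturating a code

splitView : ∀ n {r} (i : Fin (n + r)) → (∃ λ u → u ↑ˡ r ≡ i) ⊎ (∃ λ j → n ↑ʳ j ≡ i)
splitView n i with splitAt n i in eq
... | inj₁ u = inj₁ (u , splitAt⁻¹-↑ˡ eq)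
... | inj₂ j = inj₂ (j , splitAt⁻¹-↑ʳ eq)

-- The vertex n ↑ʳ j is new; its neighbourhood is E j.
extend : ∀ {r} → Graph n → (Fin r → Subset n) → Graph (n + r)
extend {n} {r} G E = record
  { Adj        = λ i j → Adj⊎ (splitAt n i) (splitAt n j)
  ; Adj?       = λ i j → Adj⊎? (splitAt n i) (splitAt n j)
  ; Adj-sym    = λ {i} {j} → Adj⊎-sym (splitAt n i) (splitAt n j)
  ; Adj-irrefl = λ {i} → Adj⊎-irrefl (splitAt n i)
  }
  where
  open Graph G

  Adj⊎ : Fin n ⊎ Fin r → Fin n ⊎ Fin r → Set
  Adj⊎ (inj₁ u) (inj₁ v) = Adj u v
  Adj⊎ (inj₁ u) (inj₂ j) = u ∈ E j
  Adj⊎ (inj₂ i) (inj₁ v) = v ∈ E i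
  -- Edges among vertices outside the code are unconstrained; the simplest choice is to have none
  -- between new ones.
  Adj⊎ (inj₂ i) (inj₂ j) = Empty.⊥

  Adj⊎? : ∀ x y → Dec (Adj⊎ x y)
  Adj⊎? (inj₁ u) (inj₁ v) = Adj? u v
  Adj⊎? (inj₁ u) (inj₂ j) = u ∈? E j
  Adj⊎? (inj₂ i) (inj₁ v) = v ∈? E i
  Adj⊎? (inj₂ i) (inj₂ j) = no λ ()

  Adj⊎-sym : ∀ x y → Adj⊎ x y → Adj⊎ y x
  Adj⊎-sym (inj₁ u) (inj₁ v) uv  = Adj-sym uv
  Adj⊎-sym (inj₁ u) (inj₂ j) u∈E = u∈E
  Adj⊎-sym (inj₂ i) (inj₁ v) v∈E = v∈E

  Adj⊎-irrefl : ∀ x → ¬ Adj⊎ x x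
  Adj⊎-irrefl (inj₁ u) = Adj-irrefl

module Saturation (G : Graph n) (D : Subset n) where
  private module G = Graph G

  -- All vertices of `G` count as realizing a subset, those outside `D` included, so no new vertex
  -- duplicates the trace of an old one.
  Missing : Subset n → Set
  Missing E = E ⊆ D × Nonempty E × ¬ Realized G D E

  missing? : Decidable Missing
  missing? E = E ⊆? D ×-dec nonempty? E ×-dec ¬? (realized? G D E)

  open Enumeration (enumerate missing?) public
    renaming (size to r; at to E; injective to E-injective;
              sound to E-missing; complete to E-complete)

  H : Graph (n + r)
  H = extend G E

  private module H = Graph H

  ι : Embedding G H
  ι = record
    { fun       = _↑ˡ r
    ; injective = ↑ˡ-injective r _ _
    ; preserves = λ {u} {v} → preserves u v
    ; reflects  = λ {u} {v} → reflects u v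
    }
    where
    preserves : ∀ u v → G.Adj u v → H.Adj (u ↑ˡ r) (v ↑ˡ r)
    preserves u v uv rewrite splitAt-↑ˡ n u r | splitAt-↑ˡ n v r = uv

    reflects : ∀ u v → H.Adj (u ↑ˡ r) (v ↑ˡ r) → G.Adj u v
    reflects u v uv rewrite splitAt-↑ˡ n u r | splitAt-↑ˡ n v r = uv

  new-adj⁺ : ∀ {j x} → x ∈ E j → H.Adj (n ↑ʳ j) (x ↑ˡ r)
  new-adj⁺ {j} {x} x∈E rewrite splitAt-↑ʳ n r j | splitAt-↑ˡ n x r = x∈E

  new-adj⁻ : ∀ {j x} → H.Adj (n ↑ʳ j) (x ↑ˡ r) → x ∈ E j
  new-adj⁻ {j} {x} adj rewrite splitAt-↑ʳ n r j | splitAt-↑ˡ n x r = adj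

  ↑ˡ≢↑ʳ : ∀ {u : Fin n} {j : Fin r} → u ↑ˡ r ≢ n ↑ʳ j
  ↑ˡ≢↑ʳ {u} {j} eq
    with trans (sym (splitAt-↑ˡ n u r)) (trans (cong (splitAt n) eq) (splitAt-↑ʳ n r j))
  ... | ()

  C : Subset (n + r)
  C = D ++ ⊥

  S : Subset (n + r)
  S = ⊥ {n} ++ ⊤ {r}

  ∣C∣≡∣D∣ : ∣ C ∣ ≡ ∣ D ∣
  ∣C∣≡∣D∣ = trans (∣p++q∣≡∣p∣+∣q∣ D ⊥)
    (trans (cong (∣ D ∣ +_) (∣⊥∣≡0 r)) (+-identityʳ ∣ D ∣))

  ∣S∣≡r : ∣ S ∣ ≡ r
  ∣S∣≡r = trans (∣p++q∣≡∣p∣+∣q∣ (⊥ {n}) (⊤ {r})) (cong₂ _+_ (∣⊥∣≡0 n) (∣⊤∣≡n r))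

  preimage-C : preimage (_↑ˡ r) C ≡ D
  preimage-C = trans (tabulate-cong (lookup-++ˡ D ⊥)) (tabulate∘lookup D)

  new∉C : ∀ {j} → n ↑ʳ j ∉ C
  new∉C {j} j∈C =
    ∉⊥ (lookup⇒[]= j ⊥ (trans (sym (lookup-++ʳ D ⊥ j)) ([]=⇒lookup j∈C)))

  covers : Covers (_↑ˡ r) C
  covers {i} i∈C with splitView n i
  ... | inj₁ old        = old
  ... | inj₂ (_ , refl) = contradiction i∈C new∉C

  old∉S : ∀ {u} → u ↑ˡ r ∉ S
  old∉S {u} u∈S =
    ∉⊥ (lookup⇒[]= u ⊥ (trans (sym (lookup-++ˡ ⊥ (⊤ {r}) u)) ([]=⇒lookup u∈S)))

  new∈S : ∀ {j} → n ↑ʳ j ∈ S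
  new∈S {j} = lookup⇒[]= _ S (trans (lookup-++ʳ (⊥ {n}) (⊤ {r}) j) ([]=⇒lookup (∈⊤ {x = j})))

  S⊆∁C : S ⊆ ∁ C
  S⊆∁C {i} i∈S with splitView n i
  ... | inj₁ (_ , refl) = contradiction i∈S old∉S
  ... | inj₂ (_ , refl) = x∉p⇒x∈∁p new∉C

  G≅H[∁S] : G ≅ H [ ∁ S ]
  G≅H[∁S] = embedding⇒≅ ι (∁ S) (λ u → x∉p⇒x∈∁p old∉S) covers-∁S
    where
    covers-∁S : Covers (_↑ˡ r) (∁ S)
    covers-∁S {i} i∈∁S with splitView n i
    ... | inj₁ old        = old
    ... | inj₂ (_ , refl) = contradiction new∈S (x∈∁p⇒x∉p i∈∁S)

  -- Traces are read back as subsets of the old vertices; nothing is lost, since `C` consists of old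
  -- vertices only.
  trace : Fin (n + r) → Subset n
  trace i = preimage (_↑ˡ r) (H.N[ i ] ∩ C)

  trace-old : ∀ u → trace (u ↑ˡ r) ≡ G.N[ u ] ∩ D
  trace-old u = trans (preimage-N[]∩ ι C u) (cong (G.N[ u ] ∩_) preimage-C)

  trace-new : ∀ j → trace (n ↑ʳ j) ≡ E j
  trace-new j = ⊆-antisym ⊆₁ ⊆₂
    where
    ⊆₁ : trace (n ↑ʳ j) ⊆ E j
    ⊆₁ x∈ with ∈-N[]⁻ H (p∩q⊆p _ C (∈-preimage⁻ x∈))
    ... | inj₁ adj = new-adj⁻ adj
    ... | inj₂ eq  = contradiction eq ↑ˡ≢↑ʳ

    ⊆₂ : E j ⊆ trace (n ↑ʳ j)
    ⊆₂ x∈E = ∈-preimage⁺ (x∈p∩q⁺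
      ( ∈-N[]⁺ H (inj₁ (new-adj⁺ x∈E))
      , ∈-preimage⁻ (subst (_ ∈_) (sym preimage-C) (proj₁ (E-missing j) x∈E))))

  separating : G.ClosedSeparating D → H.ClosedSeparating C
  separating sep {i} {j} i≢j eq = case (splitView n i) (splitView n j) i≢j
                                       (cong (preimage (_↑ˡ r)) eq)
    -- Two old vertices are separated by `D`, two new ones by injectivity of `E`, and an old from a
    -- new one because `E j` is the trace of no vertex of `G`.
    where
    old≢new : ∀ u j → trace (u ↑ˡ r) ≢ trace (n ↑ʳ j)
    old≢new u j eq = proj₂ (proj₂ (E-missing j))
      (u , trans (sym (trace-old u)) (trans eq (trace-new j)))

    case : ∀ {i j} → (∃ λ u → u ↑ˡ r ≡ i) ⊎ (∃ λ x → n ↑ʳ x ≡ i) →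
           (∃ λ u → u ↑ˡ r ≡ j) ⊎ (∃ λ x → n ↑ʳ x ≡ j) → i ≢ j → trace i ≢ trace j
    case (inj₁ (u , refl)) (inj₁ (v , refl)) i≢j eq =
      sep (i≢j ∘ cong (_↑ˡ r)) (trans (sym (trace-old u)) (trans eq (trace-old v)))
    case (inj₁ (u , refl)) (inj₂ (y , refl)) i≢j eq = old≢new u y eq
    case (inj₂ (x , refl)) (inj₁ (v , refl)) i≢j eq = old≢new v x (sym eq)
    case (inj₂ (x , refl)) (inj₂ (y , refl)) i≢j eq =
      i≢j (cong (n ↑ʳ_) (E-injective (trans (sym (trace-new x)) (trans eq (trace-new y)))))

  nonempty-preimage : ∀ {p : Subset (n + r)} → Nonempty (preimage (_↑ˡ r) p) → Nonempty p
  nonempty-preimage (x , x∈) = x ↑ˡ r , ∈-preimage⁻ x∈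

  trace-new-nonempty : ∀ j → Nonempty (H.N[ n ↑ʳ j ] ∩ C)
  trace-new-nonempty j = nonempty-preimage
    (subst Nonempty (sym (trace-new j)) (proj₁ (proj₂ (E-missing j))))

  dominating : G.Dominating D → H.Dominating C
  dominating dom i with splitView n i
  ... | inj₁ (u , refl) = nonempty-preimage (subst Nonempty (sym (trace-old u)) (dom u))
  ... | inj₂ (j , refl) = trace-new-nonempty j

  totalDominating : G.TotalDominating D → H.TotalDominating C
  totalDominating total i with splitView n i
  ... | inj₁ (u , refl) = nonempty-preimage (subst Nonempty
          (sym (trans (preimage-N⟨⟩∩ ι C u) (cong (G.N⟨ u ⟩ ∩_) preimage-C))) (total u))
  ... | inj₂ (j , refl) =
          subst Nonempty (sym (N⟨⟩∩≡N[]∩ H C new∉C)) (trace-new-nonempty j)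

  isCode : ∀ X → IsCode X G D → IsCode X H C
  isCode ID  (sep , dom)   = separating sep , dominating dom
  isCode ITD (sep , total) = separating sep , totalDominating total

  -- Pulled back to `D`, the set `F` is either already a trace in `G` or missing there, and then
  -- some new vertex was added for it.
  saturated : ∀ {F} → F ⊆ C → Nonempty F → Realized H C F
  saturated {F} F⊆C F≢∅ with realized? G D (preimage (_↑ˡ r) F)
  ... | yes (u , eq) = u ↑ˡ r ,
          preimage-injective covers (p∩q⊆q _ C) F⊆C (trans (trace-old u) eq)
  ... | no ¬realized with E-complete (F⊆D , preimage-nonempty covers F⊆C F≢∅ , ¬realized)
    where
    F⊆D : preimage (_↑ˡ r) F ⊆ D
    F⊆D x∈ = subst (_ ∈_) preimage-C (∈-preimage⁺ (F⊆C (∈-preimage⁻ x∈)))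
  ...   | j , eq = n ↑ʳ j ,
          preimage-injective covers (p∩q⊆q _ C) F⊆C (trans (trace-new j) eq)

-- Bounds from the logarithm

n<2^k⇒⌈log₂⌉≤k : ∀ {n k} → n < 2 ^ k → ⌈log₂ (n + 1) ⌉ ≤ k
n<2^k⇒⌈log₂⌉≤k {n} {k} n<2^k = subst (⌈log₂ (n + 1) ⌉ ≤_) (⌈log₂2^n⌉≡n k)
  (⌈log₂⌉-mono-≤ (≤-trans (≤-reflexive (+-comm n 1)) n<2^k))

⌈log₂⌉≡1+k⇒2^k≤n : ∀ {n k} → suc k ≡ ⌈log₂ (n + 1) ⌉ → 2 ^ k ≤ n
⌈log₂⌉≡1+k⇒2^k≤n {n} {k} eq = ≮⇒≥ λ n<2^k → 1+n≰n (subst (_≤ k) (sym eq) (n<2^k⇒⌈log₂⌉≤k n<2^k))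

-- The value of the logarithm forces `n` to be at least `2 ^ (k ∸ 1)`, half of `2 ^ k`, so `r` is
-- strictly below the other half.
excess-bound : ∀ {n r k} → 3 ≤ k → k ≡ ⌈log₂ (n + 1) ⌉ → n + r < 2 ^ k →
               r ≤ 2 ^ (k ∸ 1) ∸ 1
excess-bound {n} {r} {suc k} _ eq n+r<2^k = ∸-monoˡ-≤ 1
  (+-cancelˡ-≤ (2 ^ k) (suc r) (2 ^ k)
    (≤-trans (+-monoˡ-≤ (suc r) (⌈log₂⌉≡1+k⇒2^k≤n eq))
    (≤-trans (≤-reflexive (+-suc n r))
    (≤-trans n+r<2^k (≤-reflexive (cong (2 ^ k +_) (+-identityʳ (2 ^ k))))))))

-- The equivalence

theorem7 : (X : CodeType) (n : ℕ) (G : Graph n) → Admissible X G →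
    (k : ℕ) → k ≡ ⌈log₂ (n + 1) ⌉ → 3 ≤ k →
    (γ X ⟨ G ⟩≐ k) ⇔
    (Σ[ m ∈ ℕ ] Σ[ H ∈ Graph m ] Σ[ C ∈ Subset m ]
    IsGᴵ H C k × Admissible X (H [ C ]) ×
    (Σ[ S ∈ Subset m ]
    S ⊆ ∁ C × ∣ S ∣ ≤ 2 ^ (k ∸ 1) ∸ 1 × G ≅ H [ ∁ S ]))
theorem7 X n G _ k k≡log 3≤k = mk⇔ ⇒ ⇐
  where
  lower-bound : ∀ D → IsCode X G D → k ≤ ∣ D ∣
  lower-bound D code = subst (_≤ ∣ D ∣) (sym k≡log)
    (n<2^k⇒⌈log₂⌉≤k {k = ∣ D ∣} (order<2^∣code∣ G (isCode⇒ID G X code)))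

  Reduction : Set₁
  Reduction =
    Σ[ m ∈ ℕ ] Σ[ H ∈ Graph m ] Σ[ C ∈ Subset m ]
    IsGᴵ H C k × Admissible X (H [ C ]) ×
    (Σ[ S ∈ Subset m ]
    S ⊆ ∁ C × ∣ S ∣ ≤ 2 ^ (k ∸ 1) ∸ 1 × G ≅ H [ ∁ S ])

  ⇒ : γ X ⟨ G ⟩≐ k → Reduction
  ⇒ ((D , code , ∣D∣≡k) , _) =
    n + r , H , C , subst (IsGᴵ H C) ∣C∣≡k (isGᴵ H C 2≤∣C∣ idCode saturated) ,
    -- The code witnessing admissibility of `H [ C ]` is its whole vertex set, namely `C` pulled
    -- back.
    (_ , preimage-isCode (induced H C) (element-covers C) X (isCode X code)) ,
    S , S⊆∁C , subst (_≤ 2 ^ (k ∸ 1) ∸ 1) (sym ∣S∣≡r) (excess-bound 3≤k k≡log order<2^k) ,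
    G≅H[∁S]
    where
    open Saturation G D

    ∣C∣≡k : ∣ C ∣ ≡ k
    ∣C∣≡k = trans ∣C∣≡∣D∣ ∣D∣≡k

    2≤∣C∣ : 2 ≤ ∣ C ∣
    2≤∣C∣ = subst (2 ≤_) (sym ∣C∣≡k) (≤-trans (n≤1+n 2) 3≤k)

    idCode : IsCode ID H C
    idCode = isCode⇒ID H X (isCode X code)

    order<2^k : n + r < 2 ^ k
    -- The counting bound is applied to the saturated graph, whose code still has `k` elements; this
    -- limits the number of added vertices.
    order<2^k = subst (λ l → n + r < 2 ^ l) ∣C∣≡k (order<2^∣code∣ H idCode)

  ⇐ : Reduction → γ X ⟨ G ⟩≐ k
  ⇐ (m , H , C , isG , admissible , S , S⊆∁C , _ , iso) with ≅⇒embedding (∁ S) iso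
  ... | ι , covers-∁S =
    -- Pulling back `C` gives at most `k` vertices by injectivity, and the counting bound for `G`
    -- gives at least `k`.
    (D , code , ≤-antisym ∣D∣≤k (lower-bound D code)) , lower-bound
    where
    open Embedding ι

    covers : Covers fun C
    -- Only vertices outside `C` were removed, so all of `C` survives in `G`.
    covers y∈C = covers-∁S (x∉p⇒x∈∁p λ y∈S → x∈p⇒x∉∁p y∈C (S⊆∁C y∈S))

    D : Subset n
    D = preimage fun C

    code : IsCode X G D
    code = preimage-isCode ι covers X (isGᴵ⇒isCode H C isG X admissible)

    ∣D∣≤k : ∣ D ∣ ≤ k
    ∣D∣≤k = subst (∣ D ∣ ≤_) (IsGᴵ.∣C∣≡k isG) (∣preimage∣≤ injective C)
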